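{- Let $q$ be a prime power, let $n\ge k\ge1$ be integers, and let $\mathcal{C}$ be an $[n,k,d]_q$ minimal code. Then $n\ge (q+1)(k-1)$.
   Context: For $v\in\mathbb{F}_q^n$, the support is $\sigma(v)=\{i : v_i\ne 0\}$ and the weight is $\omega(v)=|\sigma(v)|$. An $[n,k,d]_q$ code is an $\mathbb{F}_q$-linear subspace $\mathcal{C}\subseteq\mathbb{F}_q^n$ of dimension $k\ge 1$ with minimum distance $d=\min\{\omega(c): c\in\mathcal{C},\ c\neq 0\}$. A nonzero codeword $c\in\mathcal{C}$ is minimal if every $c'\in\mathcal{C}$ with $\sigma(c')\subseteq\sigma(c)$ is a scalar multiple of $c$. The code $\mathcal{C}$ is minimal if all its nonzero codewords are minimal. -}

module Defs where

open import Algebra.Bundles using (CommutativeRing)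
import Algebra.Definitions
open import Data.Bool.Base using (not)
open import Data.Fin.Base using (Fin)
import Data.Fin.Properties as Fin
open import Data.Fin.Subset using (Subset; _⊆_; ∣_∣)
open import Data.Nat.Base using (ℕ; _≤_; _^_)
open import Data.Nat.Primality using (Prime)
open import Data.Product.Base using (∃; ∃₂; ∃-syntax; _×_)
import Data.Vec.Base as Vec
open import Data.Vec.Functional using (Vector; replicate; zipWith; map)
import Data.Vec.Functional.Relation.Binary.Equality.Setoid as VectorEquality
open import Function.Bundles using (Inverse)
open import Function.Properties.Inverse using (Inverse⇒Injection)
open import Level using (Level; _⊔_) renaming (suc to lsuc)
open import Relation.Binary.Definitions using (Decidable)
open import Relation.Binary.PropositionalEquality using (_≡_)
import Relation.Binary.PropositionalEquality as ≡
open import Relation.Nullary.Decidable using (does; via-injection)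
open import Relation.Nullary.Negation using (¬_)
open import Relation.Unary using (Pred)

IsPrimePower : ℕ → Set
IsPrimePower q = ∃₂ λ p m → Prime p × 1 ≤ m × q ≡ p ^ m

-- A field with exactly q elements (counted up to _≈_).  The enumeration makes
-- _≈_ decidable, so the classical field axiom "every nonzero element is
-- invertible" can be used without an apartness relation.
record FiniteField (q : ℕ) (c ℓ : Level) : Set (lsuc (c ⊔ ℓ)) where
  field
    commutativeRing : CommutativeRing c ℓ

  open CommutativeRing commutativeRing public
  open Algebra.Definitions _≈_ using (Invertible)

  field
    1≉0           : ¬ (1# ≈ 0#)
    ≉0⇒invertible : ∀ x → ¬ (x ≈ 0#) → Invertible 1# _*_ x
    enumeration   : Inverse setoid (≡.setoid (Fin q))

  infix 4 _≟_
  _≟_ : Decidable _≈_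
  _≟_ = via-injection (Inverse⇒Injection enumeration) Fin._≟_

module LinearCodes {q : ℕ} {c ℓ : Level} (F : FiniteField q c ℓ) where

  open FiniteField F
  open import Algebra.Definitions.RawMonoid +-rawMonoid using (sum)
  open VectorEquality setoid public using (_≋_)

  infixl 6 _+ᵛ_
  infixr 7 _·ᵛ_

  0ᵛ : ∀ {n} → Vector Carrier n
  0ᵛ {n} = replicate n 0#

  _+ᵛ_ : ∀ {n} → Vector Carrier n → Vector Carrier n → Vector Carrier n
  _+ᵛ_ = zipWith _+_

  _·ᵛ_ : ∀ {n} → Carrier → Vector Carrier n → Vector Carrier n
  a ·ᵛ v = map (a *_) v

  linearCombination : ∀ {n k} → Vector Carrier k → Vector (Vector Carrier n) k →
                      Vector Carrier n
  linearCombination a b j = sum (λ i → a i * b i j)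

  record IsSubspace {n p} (C : Pred (Vector Carrier n) p) : Set (c ⊔ ℓ ⊔ p) where
    field
      resp-≋    : ∀ {u v} → u ≋ v → C u → C v
      0ᵛ-mem    : C 0ᵛ
      +ᵛ-closed : ∀ {u v} → C u → C v → C (u +ᵛ v)
      ·ᵛ-closed : ∀ a {v} → C v → C (a ·ᵛ v)

  record IsBasis {n k p} (C : Pred (Vector Carrier n) p)
                 (b : Vector (Vector Carrier n) k) : Set (c ⊔ ℓ ⊔ p) where
    field
      mem         : ∀ i → C (b i)
      independent : ∀ a → linearCombination a b ≋ 0ᵛ → ∀ i → a i ≈ 0#
      spanning    : ∀ v → C v → ∃[ a ] v ≋ linearCombination a b

  HasDimension : ∀ {n p} → Pred (Vector Carrier n) p → ℕ → Set (c ⊔ ℓ ⊔ p)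
  HasDimension {n} C k = ∃ λ (b : Vector (Vector Carrier n) k) → IsBasis C b

  support : ∀ {n} → Vector Carrier n → Subset n
  support v = Vec.tabulate (λ i → not (does (v i ≟ 0#)))

  weight : ∀ {n} → Vector Carrier n → ℕ
  weight v = ∣ support v ∣

  record IsMinimumDistance {n p} (C : Pred (Vector Carrier n) p) (d : ℕ) :
                           Set (c ⊔ ℓ ⊔ p) where
    field
      attained   : ∃[ v ] (C v × ¬ (v ≋ 0ᵛ) × weight v ≡ d)
      lowerBound : ∀ v → C v → ¬ (v ≋ 0ᵛ) → d ≤ weight v

  record IsCode {p} (n k d : ℕ) (C : Pred (Vector Carrier n) p) :
                Set (c ⊔ ℓ ⊔ p) where
    field
      isSubspace      : IsSubspace C
      1≤k             : 1 ≤ k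
      dimension       : HasDimension C k
      minimumDistance : IsMinimumDistance C d

  record IsMinimalCodeword {n p} (C : Pred (Vector Carrier n) p)
                           (v : Vector Carrier n) : Set (c ⊔ ℓ ⊔ p) where
    field
      mem     : C v
      nonzero : ¬ (v ≋ 0ᵛ)
      minimal : ∀ u → C u → support u ⊆ support v → ∃[ a ] u ≋ a ·ᵛ v

  IsMinimalCode : ∀ {n p} → Pred (Vector Carrier n) p → Set (c ⊔ ℓ ⊔ p)
  IsMinimalCode C = ∀ v → C v → ¬ (v ≋ 0ᵛ) → IsMinimalCodeword C v

{-# OPTIONS --safe #-}

-- For codewords x, y spanning a plane U of C, consider the q + 1 points u of
-- P(U), each with some y' completing it to a basis of U.  The sets
--   I_u = { i : u i = 0, y' i ≠ 0 }
-- are pairwise disjoint.  If some I_u has fewer than k - 1 elements, elimination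
-- gives 0 ≠ v ∈ C vanishing on I_u and at one coordinate where u does not; as u
-- is minimal, v does not vanish on all zeros of u, and then u, y' + v span a
-- plane with strictly larger support.  Hence for U of maximal support
-- all q + 1 sets have at least k - 1 elements, so n ≥ (q + 1)(k - 1).

module Submission where

open import Defs
open import Data.Nat.Base using (ℕ; _≤_; _≥_; _+_; _*_; _∸_)
open import Data.Vec.Functional using (Vector)
open import Level using (Level)
open import Relation.Unary using (Pred)

import Algebra.Properties.AbelianGroup as AbelianGroupProperties
import Algebra.Properties.Ring as RingProperties
import Algebra.Properties.Semiring.Sum as SemiringSum
open import Data.Bool.Base using (true)
open import Data.Fin.Base using (Fin; zero; suc; punchIn; remQuot; combine; inject≤)
import Data.Fin.Properties as Fin
open import Data.Fin.Subset using (Subset; _∈_; _⊂_)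
open import Data.Fin.Subset.Induction using (⊂-wellFounded)
import Data.List.Base as List
open import Data.List.Membership.Propositional.Properties
  using (∈-filter⁺; ∈-filter⁻; ∈-allFin; ∈-lookup)
import Data.List.Relation.Unary.All as All
open import Data.List.Relation.Unary.AllPairs using (_∷_)
open import Data.List.Relation.Unary.Any using (index)
open import Data.List.Relation.Unary.Any.Properties using (lookup-index)
open import Data.List.Relation.Unary.Unique.Propositional using (Unique)
open import Data.List.Relation.Unary.Unique.Propositional.Properties using (filter⁺; allFin⁺)
open import Data.Nat.Base using (zero; suc; _<_; s≤s; z≤n)
import Data.Nat.Properties as ℕ
open import Data.Product.Base using (∃; ∃-syntax; _×_; _,_; proj₁; proj₂)
open import Data.Sum.Base using (_⊎_; inj₁; inj₂)
import Data.Vec.Base as Vec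
open import Data.Vec.Functional using (head; tail; insertAt)
open import Data.Vec.Functional.Properties using (insertAt-lookup; insertAt-punchIn)
import Data.Vec.Properties as Vec
open import Function.Base using (_∘_)
open import Function.Bundles using (Inverse)
open import Induction.WellFounded using (Acc; acc)
open import Relation.Binary.PropositionalEquality using (_≡_)
import Relation.Binary.PropositionalEquality as ≡
import Relation.Binary.Reasoning.Setoid as SetoidReasoning
open import Relation.Nullary.Decidable
  using (Dec; yes; no; does; ¬?; _×-dec_; dec-true; decidable-stable)
open import Relation.Nullary.Negation using (¬_; contradiction)
open import Relation.Unary using (Decidable)

-- Finite sets

lookup-injective : ∀ {a} {A : Set a} {xs : List.List A} → Unique xs →
                   ∀ i j → List.lookup xs i ≡ List.lookup xs j → i ≡ j
lookup-injective (_ ∷ _)    zero    zero    _  = ≡.refl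
lookup-injective (x∉xs ∷ _) zero    (suc j) eq =
  contradiction eq (All.lookup x∉xs (∈-lookup j))
lookup-injective (x∉xs ∷ _) (suc i) zero    eq =
  contradiction (≡.sym eq) (All.lookup x∉xs (∈-lookup i))
lookup-injective (_ ∷ xs!)  (suc i) (suc j) eq =
  ≡.cong suc (lookup-injective xs! i j eq)

module _ {n p} {P : Pred (Fin n) p} (P? : Decidable P) where

  -- `f` need not be injective or stay inside `P`: it serves as a list of fewer than `m` coordinates
  -- at which a codeword is made to vanish, so covering `P` is enough.
  FewerThan : ℕ → Set p
  FewerThan m = ∃[ s ] (s < m × ∃ λ (f : Fin s → Fin n) → ∀ i → P i → ∃[ t ] f t ≡ i)

  AtLeast : ℕ → Set p
  AtLeast m = ∃ λ (f : Fin m → Fin n) → (∀ s t → f s ≡ f t → s ≡ t) × (∀ t → P (f t))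

  fewerThan⊎atLeast : ∀ m → FewerThan m ⊎ AtLeast m
  fewerThan⊎atLeast m with m ℕ.≤? List.length (List.filter P? (List.allFin n))
  ... | no m≰len = inj₁ (_ , ℕ.≰⇒> m≰len , List.lookup xs , λ i pi →
          let i∈xs = ∈-filter⁺ P? (∈-allFin i) pi
          in index i∈xs , ≡.sym (lookup-index i∈xs))
    where xs = List.filter P? (List.allFin n)
  ... | yes m≤len = inj₂ (f , f-injective , λ t →
          proj₂ (∈-filter⁻ P? {xs = List.allFin n} (∈-lookup (inject≤ t m≤len))))
    where
    xs = List.filter P? (List.allFin n)
    f = λ t → List.lookup xs (inject≤ t m≤len)
    f-injective : ∀ s t → f s ≡ f t → s ≡ t
    f-injective s t eq = Fin.inject≤-injective m≤len m≤len s t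
      (lookup-injective (filter⁺ P? (allFin⁺ n)) _ _ eq)

  fromDec : Subset n
  fromDec = Vec.tabulate (does ∘ P?)

  ∈-fromDec⁺ : ∀ {i} → P i → i ∈ fromDec
  ∈-fromDec⁺ {i} pi = Vec.lookup⇒[]= i fromDec
    (≡.trans (Vec.lookup∘tabulate (does ∘ P?) i) (dec-true (P? i) pi))

  ∈-fromDec⁻ : ∀ {i} → i ∈ fromDec → P i
  ∈-fromDec⁻ {i} i∈ = go (P? i)
    (≡.trans (≡.sym (Vec.lookup∘tabulate (does ∘ P?) i)) (Vec.[]=⇒lookup i∈))
    where
    go : (d : Dec (P i)) → does d ≡ true → P i
    go (yes pi) _ = pi

∃⊎∀ : ∀ {n a b} {P : Pred (Fin n) a} {Q : Pred (Fin n) b} →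
      (∀ i → P i ⊎ Q i) → ∃ P ⊎ (∀ i → Q i)
∃⊎∀ {zero}  _   = inj₂ λ ()
∃⊎∀ {suc n} P⊎Q with P⊎Q zero | ∃⊎∀ (P⊎Q ∘ suc)
... | inj₁ p₀ | _            = inj₁ (zero , p₀)
... | inj₂ _  | inj₁ (i , p) = inj₁ (suc i , p)
... | inj₂ q₀ | inj₂ qs      = inj₂ (Fin.∀-cons q₀ qs)

-- The `r` injections glue to a single one on `Fin r × Fin m`: a value shared by two blocks lies in
-- both sets, so the blocks agree, and injectivity within the block finishes.
disjoint⇒≤ : ∀ {r m n p} {P : Fin r → Pred (Fin n) p} (P? : ∀ l → Decidable (P l)) →
             (∀ {l l′ i} → P l i → P l′ i → l ≡ l′) →
             (∀ l → AtLeast (P? l) m) → r * m ≤ n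
disjoint⇒≤ {r} {m} {n} {P = P} P? disjoint large = Fin.injective⇒≤ {f = g ∘ remQuot {r} m}
  (λ {s} {t} eq → ≡.trans (≡.sym (Fin.combine-remQuot {r} m s))
    (≡.trans (≡.cong (λ (l , i) → combine l i) (g-injective _ _ eq))
             (Fin.combine-remQuot {r} m t)))
  where
  g : Fin r × Fin m → Fin n
  g (l , t) = proj₁ (large l) t

  g∈ : ∀ lt → P (proj₁ lt) (g lt)
  g∈ (l , t) = proj₂ (proj₂ (large l)) t

  g-injective : ∀ x y → g x ≡ g y → x ≡ y
  g-injective (l , s) (l′ , t) eq
    with ≡.refl ← disjoint (≡.subst (P l) eq (g∈ (l , s))) (g∈ (l′ , t))
    = ≡.cong (l ,_) (proj₁ (proj₂ (large l)) s t eq)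

module _ {q : ℕ} {c ℓ : Level} (F : FiniteField q c ℓ) where

  private
    module F = FiniteField F

  open F using (Carrier; _≈_; _≟_; 0#; 1#; setoid; trans; sym; refl)
  open F using () renaming (_+_ to _⊕_; _*_ to _⊛_; -_ to ⊖_)
  open LinearCodes F
  open SemiringSum F.semiring
    using (sum; sum-cong-≋; sum-remove; ∑-distrib-+; *-distribʳ-sum; sum-replicate-zero)
  open AbelianGroupProperties F.+-abelianGroup using () renaming (∙-cancelˡ to +-cancelˡ)
  open RingProperties F.ring using (-‿distribˡ-*)

  -- Linear algebra over F

  *-cancelʳ-≉0 : ∀ {a b z} → ¬ z ≈ 0# → a ⊛ z ≈ b ⊛ z → a ≈ b
  *-cancelʳ-≉0 {a} {b} {z} z≉0 az≈bz with w , _ , zw≈1 ← F.≉0⇒invertible z z≉0 = begin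
    a            ≈⟨ F.*-identityʳ a ⟨
    a ⊛ 1#       ≈⟨ F.*-congˡ zw≈1 ⟨
    a ⊛ (z ⊛ w)  ≈⟨ F.*-assoc a z w ⟨
    a ⊛ z ⊛ w    ≈⟨ F.*-congʳ az≈bz ⟩
    b ⊛ z ⊛ w    ≈⟨ F.*-assoc b z w ⟩
    b ⊛ (z ⊛ w)  ≈⟨ F.*-congˡ zw≈1 ⟩
    b ⊛ 1#       ≈⟨ F.*-identityʳ b ⟩
    b            ∎
    where open SetoidReasoning setoid

  sum-zero : ∀ {n} (t : Vector Carrier n) → (∀ i → t i ≈ 0#) → sum t ≈ 0#
  sum-zero {n} t t≈0 = trans (sum-cong-≋ t≈0) (sum-replicate-zero n)

  module _ {s k : ℕ} (A : Vector (Vector Carrier s) (suc k)) (p : Fin (suc k))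
           (e : Vector Carrier k) where

    -- Elimination with pivot row `p`. The multipliers `e` stay free, as `linearCombination-unshear`
    -- holds for all of them.
    shear : Vector (Vector Carrier s) k
    shear i j = A (punchIn p i) j ⊕ e i ⊛ A p j

    -- In a combination of sheared rows the pivot row occurs once per row, with total coefficient
    -- the inserted sum.
    unshear : Vector Carrier k → Vector Carrier (suc k)
    unshear a = insertAt a p (sum (λ i → a i ⊛ e i))

    linearCombination-unshear : ∀ a →
      linearCombination (unshear a) A ≋ linearCombination a shear
    linearCombination-unshear a j = begin
      sum (λ i → unshear a i ⊛ A i j)
        ≈⟨ sum-remove {i = p} (λ i → unshear a i ⊛ A i j) ⟩
      unshear a p ⊛ x ⊕ sum (λ i → unshear a (punchIn p i) ⊛ A (punchIn p i) j)
        ≈⟨ F.+-cong (F.*-congʳ (F.reflexive (insertAt-lookup a p _)))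
             (sum-cong-≋ {n = k} (λ i → F.*-congʳ (F.reflexive (insertAt-punchIn a p _ i)))) ⟩
      sum (λ i → a i ⊛ e i) ⊛ x ⊕ sum (λ i → a i ⊛ A (punchIn p i) j)
        ≈⟨ F.+-comm _ _ ⟩
      sum (λ i → a i ⊛ A (punchIn p i) j) ⊕ sum (λ i → a i ⊛ e i) ⊛ x
        ≈⟨ F.+-congˡ (*-distribʳ-sum x (λ i → a i ⊛ e i)) ⟩
      sum (λ i → a i ⊛ A (punchIn p i) j) ⊕ sum (λ i → a i ⊛ e i ⊛ x)
        ≈⟨ ∑-distrib-+ (λ i → a i ⊛ A (punchIn p i) j) (λ i → a i ⊛ e i ⊛ x) ⟨
      sum (λ i → a i ⊛ A (punchIn p i) j ⊕ a i ⊛ e i ⊛ x)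
        ≈⟨ sum-cong-≋ {n = k} (λ i → trans (F.+-congˡ (F.*-assoc (a i) (e i) x)) (sym (F.distribˡ _ _ _))) ⟩
      sum (λ i → a i ⊛ shear i j) ∎
      where
      open SetoidReasoning setoid
      x = A p j

  -- Gaussian elimination by induction on the number `s` of columns. A zero column is dropped;
  -- otherwise a pivot clears the column, and its row and the column go together, which preserves
  -- `s < k`.
  linearlyDependent : ∀ {s k} → s < k → (A : Vector (Vector Carrier s) k) →
                      ∃[ a ] ((∃[ i ] ¬ a i ≈ 0#) × linearCombination a A ≋ 0ᵛ)
  -- Without columns any nonzero coefficient vector works.
  linearlyDependent {zero}  {suc k} _ A = (λ _ → 1#) , (zero , F.1≉0) , λ ()
  linearlyDependent {suc s} {suc k} (s≤s s<k) A with Fin.any? (λ i → ¬? (A i zero ≟ 0#))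
  ... | no ∄p with a , a≉0 , eq ← linearlyDependent (ℕ.m<n⇒m<1+n s<k) (tail ∘ A) =
        a , a≉0 , λ where
          zero    → sum-zero (λ i → a i ⊛ A i zero) λ i →
            trans (F.*-congˡ (decidable-stable (A i zero ≟ 0#) (λ ≉0 → ∄p (i , ≉0))))
                  (F.zeroʳ _)
          (suc j) → eq j
  ... | yes (p , Ap≉0)
        with w , w*Ap≈1 , _ ← F.≉0⇒invertible _ Ap≉0
        with a , (i , ai≉0) , eq ← linearlyDependent s<k
               (tail ∘ shear A p (λ i → ⊖ (A (punchIn p i) zero ⊛ w))) =
        unshear A p e a
        -- Off the pivot `unshear` keeps the coefficients of `a`, so the nonzero one survives at a
        -- shifted index.
        , (punchIn p i , λ ≈0 → ai≉0
            (trans (F.reflexive (≡.sym (insertAt-punchIn a p _ i))) ≈0))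
        , λ j → trans (linearCombination-unshear A p e a j) (vanishes j)
    where
    -- `w` inverts the pivot entry, so this multiplier clears column `zero`.
    e : Vector Carrier k
    e i = ⊖ (A (punchIn p i) zero ⊛ w)

    shear-zero : ∀ i → shear A p e i zero ≈ 0#
    shear-zero i = begin
      z ⊕ ⊖ (z ⊛ w) ⊛ A p zero    ≈⟨ F.+-congˡ (-‿distribˡ-* _ _) ⟨
      z ⊕ ⊖ (z ⊛ w ⊛ A p zero)    ≈⟨ F.+-congˡ (F.-‿cong (F.*-assoc _ _ _)) ⟩
      z ⊕ ⊖ (z ⊛ (w ⊛ A p zero))  ≈⟨ F.+-congˡ (F.-‿cong (F.*-congˡ w*Ap≈1)) ⟩
      z ⊕ ⊖ (z ⊛ 1#)              ≈⟨ F.+-congˡ (F.-‿cong (F.*-identityʳ z)) ⟩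
      z ⊕ ⊖ z                     ≈⟨ F.-‿inverseʳ z ⟩
      0#                          ∎
      where
      open SetoidReasoning setoid
      z = A (punchIn p i) zero

    vanishes : linearCombination a (shear A p e) ≋ 0ᵛ
    vanishes zero    = sum-zero (λ i → a i ⊛ shear A p e i zero)
                         (λ i → trans (F.*-congˡ (shear-zero i)) (F.zeroʳ _))
    vanishes (suc j) = eq j

  linearCombination-closed : ∀ {n k p} {C : Pred (Vector Carrier n) p} → IsSubspace C →
    (a : Vector Carrier k) (b : Vector (Vector Carrier n) k) → (∀ i → C (b i)) →
    C (linearCombination a b)
  linearCombination-closed {k = zero}  C-sub a b b∈C = IsSubspace.0ᵛ-mem C-sub
  linearCombination-closed {k = suc k} C-sub a b b∈C =
    +ᵛ-closed (·ᵛ-closed (head a) (b∈C zero))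
              (linearCombination-closed C-sub (tail a) (tail b) (b∈C ∘ suc))
    where open IsSubspace C-sub

  -- `support v` is definitionally `fromDec` of a negated decision, because `does` of `¬?` computes
  -- to `not`.
  ∈-support⁺ : ∀ {n} (v : Vector Carrier n) {i} → ¬ v i ≈ 0# → i ∈ support v
  ∈-support⁺ v = ∈-fromDec⁺ (λ i → ¬? (v i ≟ 0#))

  ∈-support⁻ : ∀ {n} (v : Vector Carrier n) {i} → i ∈ support v → ¬ v i ≈ 0#
  ∈-support⁻ v = ∈-fromDec⁻ (λ i → ¬? (v i ≟ 0#))

  -- The points of a projective line

  -- (basis₁ l x y , basis₂ l x y) is a basis of ⟨ x , y ⟩ whose first vector is
  -- the point l of the projective line, point zero being x.
  basis₁ basis₂ : ∀ {n} → Fin (suc q) → Vector Carrier n → Vector Carrier n → Vector Carrier n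
  basis₁ zero    x y = x
  basis₁ (suc l) x y = y +ᵛ Inverse.from F.enumeration l ·ᵛ x
  basis₂ zero    x y = y
  basis₂ (suc l) x y = x

  module _ {n : ℕ} (x y : Vector Carrier n) where

    CommonZero : Pred (Fin n) ℓ
    CommonZero i = x i ≈ 0# × y i ≈ 0#

    commonZero? : Decidable CommonZero
    commonZero? i = (x i ≟ 0#) ×-dec (y i ≟ 0#)

    OnlyZero : Pred (Fin n) ℓ
    OnlyZero i = x i ≈ 0# × ¬ y i ≈ 0#

    onlyZero? : Decidable OnlyZero
    onlyZero? i = (x i ≟ 0#) ×-dec ¬? (y i ≟ 0#)

  a+b*0≈a : ∀ {a b z} → z ≈ 0# → a ⊕ b ⊛ z ≈ a
  a+b*0≈a z≈0 = trans (F.+-congˡ (trans (F.*-congˡ z≈0) (F.zeroʳ _))) (F.+-identityʳ _)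

  commonZero-basis : ∀ {n} {x y : Vector Carrier n} l {i} →
                     CommonZero (basis₁ l x y) (basis₂ l x y) i → CommonZero x y i
  commonZero-basis zero    z           = z
  commonZero-basis (suc l) (u≈0 , x≈0) = x≈0 , trans (sym (a+b*0≈a x≈0)) u≈0

  -- At a coordinate where the plane does not vanish identically, the vectors of the plane that
  -- vanish there form a single point of the projective line.
  onlyZero-disjoint : ∀ {n} {x y : Vector Carrier n} {l l′ i} →
    OnlyZero (basis₁ l x y) (basis₂ l x y) i →
    OnlyZero (basis₁ l′ x y) (basis₂ l′ x y) i → l ≡ l′
  onlyZero-disjoint {l = zero}  {zero}   _         _          = ≡.refl
  onlyZero-disjoint {l = zero}  {suc _}  (x≈0 , _) (_ , x≉0)  = contradiction x≈0 x≉0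
  onlyZero-disjoint {l = suc _} {zero}   (_ , x≉0) (x≈0 , _)  = contradiction x≈0 x≉0
  -- Cancelling `y i` and then `x i` identifies the two scalars, and the enumeration recovers their
  -- indices.
  onlyZero-disjoint {l = suc l} {suc l′} (u≈0 , x≉0) (u′≈0 , _) = ≡.cong suc
    (≡.trans (≡.sym (strictlyInverseˡ l)) (≡.trans
      (to-cong (*-cancelʳ-≉0 x≉0 (+-cancelˡ _ _ _ (trans u≈0 (sym u′≈0)))))
      (strictlyInverseˡ l′)))
    where open Inverse F.enumeration using (strictlyInverseˡ; to-cong)

  -- Minimal codes and planes of growing support

  module _ {n m d p} {C : Pred (Vector Carrier n) p}
           (code : IsCode n (suc m) d C) (minimal : IsMinimalCode C) where

    open IsCode code using (isSubspace; dimension)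
    open IsSubspace isSubspace

    -- Vanishing at `j` and on `f` imposes at most `m` conditions on a code of dimension `suc m`, so
    -- some nonzero `v` meets them. Were its support inside that of `u`, minimality would give
    -- `v ≋ e ·ᵛ u`; evaluating at `j` forces `e ≈ 0#`, hence `v ≋ 0ᵛ`.
    exists-separating : ∀ {u j} → C u → ¬ u j ≈ 0# → ∀ {s} → s < m → (f : Fin s → Fin n) →
                        ∃[ v ] (C v × (∀ t → v (f t) ≈ 0#) × ∃[ r ] OnlyZero u v r)
    exists-separating {u} {j} u∈C uj≉0 {s} s<m f
      with b , b-basis ← dimension
      with a , (i , ai≉0) , eq ← linearlyDependent (s≤s s<m)
             (λ i → λ { zero → b i j ; (suc t) → b i (f t) })
      with Fin.any? (onlyZero? u (linearCombination a b))
    ... | yes r = _ , linearCombination-closed isSubspace a b (IsBasis.mem b-basis)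
                    , eq ∘ suc , r
    ... | no ∄r = contradiction (IsBasis.independent b-basis a v≋0 i) ai≉0
      where
      v = linearCombination a b
      v∈C = linearCombination-closed isSubspace a b (IsBasis.mem b-basis)

      v-multiple : ∃[ e ] v ≋ e ·ᵛ u
      v-multiple = IsMinimalCodeword.minimal (minimal u u∈C (λ u≋0 → uj≉0 (u≋0 j))) v v∈C
        λ {r} r∈v → ∈-support⁺ u (λ ur≈0 → ∄r (r , ur≈0 , ∈-support⁻ v r∈v))

      e = proj₁ v-multiple

      e≈0 : e ≈ 0#
      e≈0 = *-cancelʳ-≉0 uj≉0
        (trans (sym (proj₂ v-multiple j)) (trans (eq zero) (sym (F.zeroˡ _))))

      v≋0 : v ≋ 0ᵛ
      v≋0 r = trans (proj₂ v-multiple r) (trans (F.*-congʳ e≈0) (F.zeroˡ _))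

    -- The common zeros form the complement of the support of the plane, so enlarging the support is
    -- well-founded recursion on `_⊂_`. The witnesses `j` and `r` make `x` and `y` independent, and
    -- each recursive call supplies new ones.
    length-bound : ∀ x y → C x → C y → (∃[ j ] ¬ x j ≈ 0#) → (∃[ r ] OnlyZero x y r) →
                   Acc _⊂_ (fromDec (commonZero? x y)) → suc q * m ≤ n
    length-bound x y x∈C y∈C (j , xj≉0) (r , xr≈0 , yr≉0) (acc rec) = go
      where
      u w : Fin (suc q) → Vector Carrier n
      u l = basis₁ l x y
      w l = basis₂ l x y

      u∈C : ∀ l → C (u l)
      u∈C zero    = x∈C
      u∈C (suc l) = +ᵛ-closed y∈C (·ᵛ-closed _ x∈C)

      w∈C : ∀ l → C (w l)
      w∈C zero    = y∈C
      w∈C (suc l) = x∈C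

      u≉0 : ∀ l → ∃[ j ] ¬ u l j ≈ 0#
      u≉0 zero    = j , xj≉0
      -- At `r` the multiple of `x` disappears and `y r` remains.
      u≉0 (suc l) = r , λ ≈0 → yr≉0 (trans (sym (a+b*0≈a xr≈0)) ≈0)

      enlarge : ∀ l → FewerThan (onlyZero? (u l) (w l)) m → suc q * m ≤ n
      enlarge l (s , s<m , f , f-covers)
        with v , v∈C , v∘f≈0 , r′ , ur′≈0 , vr′≉0
               ← exists-separating (u∈C l) (proj₂ (u≉0 l)) s<m f
        = length-bound (u l) (w l +ᵛ v) (u∈C l) (+ᵛ-closed (w∈C l) v∈C)
            (u≉0 l) (r′ , ur′≈0 , w+v≉0)
            -- `r′` makes the inclusion strict: it is a common zero of the old plane at which
            -- `w l +ᵛ v` does not vanish.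
            (rec (shrinks , r′
                 , ∈-fromDec⁺ (commonZero? x y) (commonZero-basis l (ur′≈0 , wr′≈0))
                 , λ r′∈ → w+v≉0 (proj₂ (∈-fromDec⁻ (commonZero? (u l) (w l +ᵛ v)) r′∈))))
        where
        v-vanishes : ∀ i → OnlyZero (u l) (w l) i → v i ≈ 0#
        v-vanishes i i∈ with t , ≡.refl ← f-covers i i∈ = v∘f≈0 t

        wr′≈0 : w l r′ ≈ 0#
        -- Otherwise `r′` would lie in the covered set, where `v` vanishes.
        wr′≈0 = decidable-stable (w l r′ ≟ 0#) λ ≉0 → vr′≉0 (v-vanishes r′ (ur′≈0 , ≉0))

        w+v≉0 : ¬ w l r′ ⊕ v r′ ≈ 0#
        w+v≉0 ≈0 = vr′≉0 (trans (sym (trans (F.+-congʳ wr′≈0) (F.+-identityˡ _))) ≈0)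

        w≈0 : ∀ {i} → CommonZero (u l) (w l +ᵛ v) i → w l i ≈ 0#
        -- If `w l i` were nonzero, `i` would be covered, so `v i` would vanish and the sum would
        -- equal `w l i`. Thus adding `v` creates no new common zero.
        w≈0 {i} (ui≈0 , w+v≈0) = decidable-stable (w l i ≟ 0#) λ wi≉0 → wi≉0
          (trans (sym (trans (F.+-congˡ (v-vanishes i (ui≈0 , wi≉0))) (F.+-identityʳ _))) w+v≈0)

        shrinks : ∀ {i} → i ∈ fromDec (commonZero? (u l) (w l +ᵛ v)) →
                  i ∈ fromDec (commonZero? x y)
        shrinks i∈ with z ← ∈-fromDec⁻ (commonZero? (u l) (w l +ᵛ v)) i∈ =
          ∈-fromDec⁺ (commonZero? x y) (commonZero-basis l (proj₁ z , w≈0 z))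

      go : suc q * m ≤ n
      go with ∃⊎∀ (λ l → fewerThan⊎atLeast (onlyZero? (u l) (w l)) m)
      ... | inj₁ (l , few) = enlarge l few
      ... | inj₂ large     = disjoint⇒≤ (λ l → onlyZero? (u l) (w l))
                               onlyZero-disjoint large

theorem2p14 : ∀ {c ℓ p : Level} (q : ℕ) → IsPrimePower q →
    (F : FiniteField q c ℓ) →
    (n k d : ℕ) → n ≥ k → k ≥ 1 →
    (C : Pred (Vector (FiniteField.Carrier F) n) p) →
    LinearCodes.IsCode F n k d C →
    LinearCodes.IsMinimalCode F C →
    n ≥ (q + 1) * (k ∸ 1)
theorem2p14 q _ F n (suc zero) d _ _ C code minimal
  rewrite ℕ.*-zeroʳ (q + 1) = z≤n
theorem2p14 q _ F n (suc (suc m)) d _ _ C code minimal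
  -- A word attaining the minimum distance serves only as some nonzero codeword.
  with v , v∈C , v≉0 , _ ← LinearCodes.IsMinimumDistance.attained
                             (LinearCodes.IsCode.minimumDistance code)
  with j , vj≉0 ← Fin.¬∀⟶∃¬ n _ (λ i → FiniteField._≟_ F (v i) (FiniteField.0# F)) v≉0
  -- With an empty list of coordinates, which is short enough since the dimension is at least two,
  -- separation yields the second vector of an initial plane.
  with w , w∈C , _ , r ← exists-separating F code minimal v∈C vj≉0 (s≤s z≤n) (λ ())
  rewrite ℕ.+-comm q 1
  = length-bound F code minimal v w v∈C w∈C (j , vj≉0) r (⊂-wellFounded _)
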